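{- For every integer $n \geq 3$, $R_2(c(nK_4)) = 13n-3$. Furthermore, if $R_2(2K_4) \leq 23$, then $R_2(c(2K_4)) = 23$.
   Context: For a positive integer $n$, $nK_4$ denotes the disjoint union of $n$ copies of the complete graph $K_4$. For a (disconnected) graph $H$, $c(H)$ denotes the set of all connected graphs containing $H$ as a subgraph. $R_2(c(H))$ is the least integer $N$ such that every $2$-edge-coloring of $K_N$ contains a monochromatic copy of some graph in $c(H)$. $R_2(2K_4)$ is the usual $2$-color Ramsey number of $2K_4$: the least $N$ such that every $2$-edge-coloring of $K_N$ contains a monochromatic copy of $2K_4$. -}

module Defs where

open import Level using (Level; _⊔_) renaming (suc to lsuc; zero to lzero)
open import Data.Nat using (ℕ; _<_)
open import Data.Fin using (Fin)
open import Data.Product using (Σ; ∃; _×_; _,_)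
open import Relation.Binary.PropositionalEquality using (_≡_; _≢_)
open import Relation.Nullary using (¬_)
open import Function.Definitions using (Injective)

record Graph : Set₁ where
  field
    V      : Set
    E      : V → V → Set
    sym    : ∀ {u v} → E u v → E v u
    irrefl : ∀ {u} → ¬ E u u
open Graph public

data Reachable (G : Graph) : V G → V G → Set where
  here : ∀ {u} → Reachable G u u
  step : ∀ {u w v} → E G u w → Reachable G w v → Reachable G u v

Connected : Graph → Set
Connected G = ∀ u v → Reachable G u v

_⊆G_ : Graph → Graph → Set
H ⊆G G = Σ (V H → V G) λ f →
  Injective _≡_ _≡_ f × (∀ {u v} → E H u v → E G (f u) (f v))

nK4 : ℕ → Graph
nK4 n = record
  { V = Fin n × Fin 4
  ; E = λ { (i , a) (j , b) → (i ≡ j) × (a ≢ b) }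
  ; sym = λ { {i , a} {j , b} (i≡j , a≢b) →
              (Relation.Binary.PropositionalEquality.sym i≡j ,
               λ b≡a → a≢b (Relation.Binary.PropositionalEquality.sym b≡a)) }
  ; irrefl = λ { (_ , a≢a) → a≢a Relation.Binary.PropositionalEquality.refl }
  }

-- A 2-edge-colouring of K_N: a symmetric colour assignment to pairs
-- (the value on the diagonal is irrelevant).
record Colouring (N : ℕ) : Set where
  field
    col    : Fin N → Fin N → Fin 2
    colSym : ∀ i j → col i j ≡ col j i
open Colouring public

MonoCopy : ∀ {N} → Colouring N → Fin 2 → Graph → Set
MonoCopy {N} χ k G = Σ (V G → Fin N) λ f →
  Injective _≡_ _≡_ f × (∀ {u v} → E G u v → col χ (f u) (f v) ≡ k)

Arrows : ℕ → Graph → Set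
Arrows N H = (χ : Colouring N) → Σ (Fin 2) λ k → MonoCopy χ k H

InC : Graph → Graph → Set
InC H G = Connected G × (H ⊆G G)

ArrowsC : ℕ → Graph → Set₁
ArrowsC N H = (χ : Colouring N) →
  Σ (Fin 2) λ k → Σ Graph λ G → InC H G × MonoCopy χ k G

IsLeast : ∀ {ℓ} → (ℕ → Set ℓ) → ℕ → Set ℓ
IsLeast P r = P r × (∀ m → m < r → ¬ P m)

R₂≡ : Graph → ℕ → Set
R₂≡ H r = IsLeast (λ N → Arrows N H) r

R₂c≡ : Graph → ℕ → Set₁
R₂c≡ H r = IsLeast (λ N → ArrowsC N H) r

{-# OPTIONS --safe #-}
module Submission where

-- Lower bound: take three red cliques on 4n-1 vertices and n-1 further vertices, all
-- other edges blue.  Red components are too small, and every blue K4 uses one of the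
-- n-1 further vertices.
--
-- Upper bound: if both colours are connected, disjoint monochromatic K4s are picked
-- greedily (or supplied by the hypothesis when n = 2).  Otherwise, say red is
-- disconnected, so that blue is connected.  Two facts drive this case.
--
--   (1) Any vertex set D contains red K4s, n of them, in one red component, or a blue
--       matching of size m ≤ n with m = n or |D| < 4n + m (augment a matching whose
--       uncovered vertices form a red clique).
--   (2) By R(4,3) ≤ 9 and R(4,4) ≤ 18, a large set with fewer than n disjoint red K4s
--       contains many disjoint blue triangles, and blue K4s.
--
-- Call D closed if all edges leaving it are blue.  By (1) on both sides of the cut, a
-- closed set or its complement has fewer than 5n vertices, or we are done.
-- Take a minimal closed set D with at least 8n-2 vertices.  If D is red-connected, the
-- blue cliques of (2) inside D are completed outside D.  If not, D splits into two
-- closed sets with fewer than 5n vertices; together with the complement of D there are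
-- three parts whose blue matchings from (1) have total size at least n, and each of n
-- matching edges is completed by one vertex from both other parts.

open import Defs hiding (sym)
open import Data.List using (List; []; _∷_; _++_; length; lookup; map; take; drop; allFin)
open import Data.Nat using (ℕ; zero; suc; _+_; _*_; _∸_; _≤_; _<_; z≤n; s≤s; _≤?_; _<?_)
open import Data.Nat.Properties
open import Data.Nat.Tactic.RingSolver using (solve-∀; solve)
open import Relation.Binary.PropositionalEquality using (_≡_; _≢_; refl; sym; trans; cong; cong₂; subst; setoid)

-- Linear arithmetic on natural numbers.

-- A certificate for a ≤ b: adding c to both sides turns it, up to the slack s, into
-- a known inequality x ≤ y, so that both equations are left to the ring solver.
linear : ∀ c s {a b x y} → x ≤ y → c + a ≡ x → y + s ≡ c + b → a ≤ b
linear c s {a} {b} x≤y refl q =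
  +-cancelˡ-≤ c a b (≤-trans x≤y (≤-trans (m≤m+n _ s) (≤-reflexive q)))

-- Abstract, so that with-abstraction does not normalise the ring-solver proofs.
abstract
  greedy-find : ∀ L m t x → L + (m + t * m) ≤ m + x → L ≤ x
  greedy-find L m t x h = linear (m + t * m) (t * m) h
    (solve (L ∷ m ∷ t ∷ [])) (solve (x ∷ m ∷ t ∷ []))

  greedy-rest : ∀ L m t x y → x ≡ m + y → L + (m + t * m) ≤ m + x → L + t * m ≤ m + y
  greedy-rest L m t x y refl h = linear m 0 h (solve (L ∷ m ∷ t ∷ [])) (solve (m ∷ y ∷ []))

  uncovered-large : ∀ s m n u d → suc s + m ≡ n → d ≡ m * 2 + u → n * 4 + m ≤ d → suc s * 4 + m * 3 ≤ u
  uncovered-large s m _ u _ refl refl h = linear (m * 2) 0 h (solve (s ∷ m ∷ [])) (solve (m ∷ u ∷ []))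

  few-outside : ∀ j d b → 3 + (d + b) ≡ (2 + j) * 13 → b < 2 + j → (18 + j * 8) + (2 + j) * 4 ≤ 4 + d
  few-outside j d b e h = linear (1 + b + j) 0 (+-mono-≤ (≤-reflexive (sym e)) h)
    (solve (j ∷ b ∷ [])) (solve (j ∷ b ∷ d ∷ []))

  some-outside : ∀ j d b → 3 + (d + b) ≡ (2 + j) * 13 → b < (2 + j) * 4 → (12 + j * 5) + (2 + j) * 4 ≤ 4 + d
  some-outside j d b e h = linear (7 + j * 4 + b) 0 (+-mono-≤ (≤-reflexive (sym e)) h)
    (solve (j ∷ b ∷ [])) (solve (j ∷ b ∷ d ∷ []))

  large-inside : ∀ j d → (2 + j) * 8 ≤ 2 + d → (10 + j * 4) + (2 + j) * 4 ≤ 4 + d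
  large-inside j d h = linear 0 0 (s≤s (s≤s h)) (solve (j ∷ [])) (solve (d ∷ []))

  18+4t≤ : ∀ j → 18 + (1 + j) * 4 ≤ 4 + (18 + j * 8)
  18+4t≤ j = linear 0 (j * 4) (≤-refl {18 + (1 + j) * 4}) refl (solve (j ∷ []))

  9+4t≤ : ∀ j → 9 + (1 + j) * 4 ≤ 18 + j * 8
  9+4t≤ j = linear 0 (5 + j * 4) (≤-refl {9 + (1 + j) * 4}) refl (solve (j ∷ []))

  9+3t≤₁ : ∀ j → 9 + (1 + j) * 3 ≤ 12 + j * 5
  9+3t≤₁ j = linear 0 (j * 2) (≤-refl {9 + (1 + j) * 3}) refl (solve (j ∷ []))

  9+3t≤₂ : ∀ j → 9 + (1 + j) * 3 ≤ 3 + (10 + j * 4)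
  9+3t≤₂ j = linear 0 (1 + j) (≤-refl {9 + (1 + j) * 3}) refl (solve (j ∷ []))

  4+3t≤ : ∀ j → 4 + (1 + j) * 3 ≤ 10 + j * 4
  4+3t≤ j = linear 0 (3 + j) (≤-refl {4 + (1 + j) * 3}) refl (solve (j ∷ []))

  rest-singletons : ∀ j b r → (2 + j) * 4 ≤ b → b ≡ 1 * 2 + r → 1 + j ≤ r
  rest-singletons j _ r h refl = linear (7 + j * 3) (5 + j * 3) h (solve (j ∷ [])) (solve (j ∷ r ∷ []))

  matchings-large : ∀ n s t b m₁ m₂ m₃ → n * 13 ≤ 3 + (s + (t + b)) →
    s < n * 4 + m₁ → t < n * 4 + m₂ → b < n * 4 + m₃ → n ≤ m₁ + (m₂ + m₃)
  matchings-large n s t b m₁ m₂ m₃ h h₁ h₂ h₃ =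
    linear (3 + (s + (t + b)) + n * 12) 0 (+-mono-≤ h (+-mono-≤ h₁ (+-mono-≤ h₂ h₃)))
      (solve (n ∷ s ∷ t ∷ b ∷ [])) (solve (n ∷ s ∷ t ∷ b ∷ m₁ ∷ m₂ ∷ m₃ ∷ []))

  rest-large : ∀ n e f s r → e + f ≡ n → n * 2 ≤ s → s ≡ e * 2 + r → f ≤ r
  rest-large _ e f _ r refl h refl = linear (e * 2 + f) f h (solve (e ∷ f ∷ [])) (solve (e ∷ f ∷ r ∷ []))

  cut-sizes : ∀ n s u → 3 + (s + u) ≡ n * 13 → 2 + s < n * 8 → n * 5 ≤ u
  cut-sizes n s u e h = linear (3 + n * 8 + s) 0 (+-mono-≤ (≤-reflexive (sym e)) h)
    (solve (n ∷ s ∷ [])) (solve (n ∷ s ∷ u ∷ []))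

  part-large : ∀ n s t d → 1 ≤ n → d ≡ s + t → n * 8 ≤ 2 + d → t < n * 5 → n * 2 ≤ s
  part-large n s t _ p refl h h′ = linear (2 + t + n * 6) 0 (+-mono-≤ (+-mono-≤ h h′) p)
    (solve (n ∷ t ∷ [])) (solve (n ∷ s ∷ t ∷ []))

  outside-large : ∀ n s t d b → 1 ≤ n → d ≡ s + t → 3 + (d + b) ≡ n * 13 → s < n * 5 → t < n * 5 → n * 2 ≤ b
  outside-large n s t _ b p refl e h h′ =
    linear (3 + s + t + n * 11) 0 (+-mono-≤ (≤-reflexive (sym e)) (+-mono-≤ (+-mono-≤ h h′) p))
      (solve (n ∷ s ∷ t ∷ [])) (solve (n ∷ s ∷ t ∷ b ∷ []))

  plenty : ∀ n x → 3 ≤ n → 3 + x ≡ n * 13 → 10 + (n + n) * 4 ≤ x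
  plenty n x h e = linear (5 + n * 5) 2 (+-mono-≤ (≤-reflexive (sym e)) (*-monoˡ-≤ 5 h)) (left n) (right n x)
    where
    left : ∀ n → 5 + n * 5 + (10 + (n + n) * 4) ≡ n * 13 + 15
    left = solve-∀
    right : ∀ n x → 3 + x + n * 5 + 2 ≡ 5 + n * 5 + x
    right = solve-∀

  start-large : ∀ j x → 3 + x ≡ (2 + j) * 13 → (2 + j) * 8 ≤ 2 + x
  start-large j x e = linear 1 (9 + j * 5) (≤-refl {1 + (2 + j) * 8}) refl (trans (left j) (sym e))
    where
    left : ∀ j → 1 + (2 + j) * 8 + (9 + j * 5) ≡ (2 + j) * 13
    left = solve-∀

  mono-find : ∀ a b → 18 ≤ 10 + (suc a + suc b) * 4
  mono-find a b = ≤-trans (m≤m+n 18 ((a + b) * 4)) (≤-reflexive (arith a b))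
    where
    arith : ∀ a b → 18 + (a + b) * 4 ≡ 10 + (suc a + suc b) * 4
    arith = solve-∀

  mono-rest₁ : ∀ a b x r → x ≡ 4 + r → 10 + (suc a + suc b) * 4 ≤ x → 10 + (a + suc b) * 4 ≤ r
  mono-rest₁ a b _ r refl h = +-cancelˡ-≤ 4 _ _ h

  mono-rest₂ : ∀ a b x r → x ≡ 4 + r → 10 + (suc a + suc b) * 4 ≤ x → 10 + (suc a + b) * 4 ≤ r
  mono-rest₂ a b _ r refl h = +-cancelˡ-≤ 4 _ _ (≤-trans (≤-reflexive (arith a b)) h)
    where
    arith : ∀ a b → 4 + (10 + (suc a + b) * 4) ≡ 10 + (suc a + suc b) * 4
    arith = solve-∀

-- Imported only here: the list passed to the ring solver must not be ambiguous with
-- the constructors of All and AllPairs.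
open import Data.Bool.Properties using (T-irrelevant)
open import Data.Empty using (⊥-elim)
open import Data.Fin using (Fin; zero; suc; toℕ; fromℕ<; inject≤; remQuot; combine)
open import Data.Fin.Properties using (toℕ<n; toℕ-injective; fromℕ<-injective; inject≤-injective; pigeonhole; combine-remQuot; ¬∀⟶∃¬) renaming (_≟_ to _≟ᶠ_; <⇒≢ to <ᶠ⇒≢)
import Data.List.Membership.DecPropositional as DecMembership
open import Data.List.Membership.Propositional using (_∈_)
open import Data.List.Membership.Propositional.Properties using (∈-∃++; ∈-lookup; ∈-allFin; ∈-++⁻; ∈-++⁺ˡ; ∈-++⁺ʳ)
open import Data.List.Properties using (length-++; length-take; length-tabulate; take++drop≡id; ++-conicalˡ)
open import Data.List.Relation.Binary.Permutation.Propositional using (_↭_; ↭-refl; ↭-sym; ↭-trans; ↭-prep; ↭-swap; ↭-reflexive; ↭⇒↭ₛ)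
open import Data.List.Relation.Binary.Permutation.Propositional.Properties using (shift; ++⁺; ++⁺ˡ; ++⁺ʳ; ↭-length; All-resp-↭; ∈-resp-↭; ++-commutativeMonoid) renaming (++-comm to ↭-++-comm; ++-assoc to ↭-++-assoc; ++-identityʳ to ↭-++-identityʳ; map⁺ to ↭-map⁺)
import Data.List.Relation.Binary.Permutation.Setoid.Properties as Permutationₛ
open import Data.List.Relation.Unary.All using (All; []; _∷_)
import Data.List.Relation.Unary.All as All
import Data.List.Relation.Unary.All.Properties as All
open import Data.List.Relation.Unary.AllPairs using (AllPairs; []; _∷_)
import Data.List.Relation.Unary.AllPairs.Properties as AllPairs
open import Data.List.Relation.Unary.Any using (here; there)
open import Data.List.Relation.Unary.Unique.Propositional using (Unique)
open import Data.List.Relation.Unary.Unique.Propositional.Properties using (allFin⁺)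
open import Data.Nat.DivMod using (_/_; _%_; m%n<n; m≡m%n+[m/n]*n; m/n*n≤m)
open import Data.Nat.ListAction using (sum)
open import Data.Nat.ListAction.Properties using (sum-↭)
open import Data.Product using (Σ; ∃; ∃₂; _×_; _,_; proj₁; proj₂; uncurry)
open import Data.Sum using (_⊎_; inj₁; inj₂; [_,_]′)
import Data.Sum as Sum
open import Function using (_∘_; id; const)
open import Function.Definitions using (Injective)
open import Relation.Binary.Construct.Closure.ReflexiveTransitive using (Star; ε; _◅_; _◅◅_; reverse)
open import Relation.Nullary using (Dec; yes; no; ¬_; contradiction)
open import Relation.Nullary.Decidable using (True; toWitness; fromWitness)

-- Colours, lists and elementary counting.

opp : Fin 2 → Fin 2
opp zero       = suc zero
opp (suc zero) = zero

opp-involutive : ∀ k → opp (opp k) ≡ k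
opp-involutive zero       = refl
opp-involutive (suc zero) = refl

opp-≢ : ∀ k → k ≢ opp k
opp-≢ zero       ()
opp-≢ (suc zero) ()

same-or-opp : ∀ k j → j ≡ k ⊎ j ≡ opp k
same-or-opp zero       zero       = inj₁ refl
same-or-opp zero       (suc zero) = inj₂ refl
same-or-opp (suc zero) zero       = inj₂ refl
same-or-opp (suc zero) (suc zero) = inj₁ refl

either-large : ∀ {p q} a b → suc (p + q) ≤ a + b → p < a ⊎ q < b
either-large {p} {q} a b le with p <? a | q <? b
... | yes l | _     = inj₁ l
... | no _  | yes l = inj₂ l
... | no l  | no l′ = contradiction (+-mono-≤ (≮⇒≥ l) (≮⇒≥ l′)) (<⇒≱ le)

all-or : ∀ {A X : Set} {P : X → Set} (xs : List X) →
         (∀ {x} → x ∈ xs → A ⊎ P x) → A ⊎ All P xs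
all-or []       f = inj₂ []
all-or (x ∷ xs) f with f (here refl) | all-or xs (f ∘ there)
... | inj₁ a | _       = inj₁ a
... | inj₂ _ | inj₁ a  = inj₁ a
... | inj₂ p | inj₂ ps = inj₂ (p ∷ ps)

AllPairs-++⁻ : ∀ {A : Set} {R : A → A → Set} xs {ys} → AllPairs R (xs ++ ys) →
               AllPairs R xs × AllPairs R ys × All (λ x → All (R x) ys) xs
AllPairs-++⁻ []       α       = [] , α , []
AllPairs-++⁻ (x ∷ xs) (a ∷ α) with AllPairs-++⁻ xs α
... | β , γ , cr = All.++⁻ˡ xs a ∷ β , γ , All.++⁻ʳ xs a ∷ cr

AllPairs-++⁻ˡ : ∀ {A : Set} {R : A → A → Set} xs {ys} → AllPairs R (xs ++ ys) → AllPairs R xs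
AllPairs-++⁻ˡ xs = proj₁ ∘ AllPairs-++⁻ xs

AllPairs-lookup : ∀ {A : Set} {R : A → A → Set} → (∀ {x y} → R x y → R y x) →
                  ∀ {xs} → AllPairs R xs → ∀ {i j} → i ≢ j → R (lookup xs i) (lookup xs j)
AllPairs-lookup s (_ ∷ _) {zero}  {zero}  ≢ = contradiction refl ≢
AllPairs-lookup s (a ∷ _) {zero}  {suc j} ≢ = All.lookup a (∈-lookup j)
AllPairs-lookup s (a ∷ _) {suc i} {zero}  ≢ = s (All.lookup a (∈-lookup i))
AllPairs-lookup s (_ ∷ α) {suc i} {suc j} ≢ = AllPairs-lookup s α (≢ ∘ cong suc)

split-bound : ∀ a b {n} → n ≤ a + b → ∃₂ λ e f → e ≤ a × f ≤ b × e + f ≡ n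
split-bound zero    b {n}     le       = 0 , n , z≤n , le , refl
split-bound (suc a) b {zero}  le       = 0 , 0 , z≤n , z≤n , refl
split-bound (suc a) b {suc n} (s≤s le) with split-bound a b le
... | e , f , p , q , refl = suc e , f , s≤s p , q , refl

matching-bound : ∀ n m {x} → m ≤ n → x < n * 4 + m → x < n * 5
matching-bound n m m≤n lt = ≤-trans lt (≤-trans (+-monoʳ-≤ (n * 4) m≤n) (≤-reflexive (arith n)))
  where
  arith : ∀ n → n * 4 + n ≡ n * 5
  arith = solve-∀

-- Monochromatic cliques and small Ramsey numbers.

module Cliques {V : Set} (c : V → V → Fin 2) (c-sym : ∀ x y → c x y ≡ c y x) where

  open import Algebra.Solver.CommutativeMonoid (++-commutativeMonoid {A = V})
    using (_⊕_; _⊜_) renaming (solve to solve↭)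

  Mono : Fin 2 → V → V → Set
  Mono k x y = c x y ≡ k

  mono-sym : ∀ {k x y} → Mono k x y → Mono k y x
  mono-sym {x = x} {y} p = trans (c-sym y x) p

  AllPairs-mono-resp-↭ : ∀ {k xs ys} → xs ↭ ys → AllPairs (Mono k) xs → AllPairs (Mono k) ys
  AllPairs-mono-resp-↭ p = Permutationₛ.AllPairs-resp-↭ (setoid V) mono-sym ((λ { refl → id }) , (λ { refl → id })) (↭⇒↭ₛ p)

  Clique : Fin 2 → ℕ → List V → Set
  Clique k m q = length q ≡ m × AllPairs (Mono k) q

  -- Vertex sets are lists up to permutation. The decomposition `q ++ r` keeps the remaining
  -- vertices `r` at hand, so cliques removed one after another are disjoint by construction.
  HasClique : Fin 2 → ℕ → List V → Set
  HasClique k m xs = ∃₂ λ q r → xs ↭ q ++ r × Clique k m q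

  hasClique-⊇ : ∀ {k m xs ys zs} → xs ↭ ys ++ zs → HasClique k m ys → HasClique k m xs
  hasClique-⊇ {zs = zs} p (q , r , p′ , cl) =
    q , r ++ zs , ↭-trans p (↭-trans (++⁺ʳ zs p′) (↭-++-assoc q r zs)) , cl

  hasClique-∷ : ∀ {k m x xs ys zs} → xs ↭ x ∷ ys ++ zs → All (Mono k x) ys →
                HasClique k m ys → HasClique k (suc m) xs
  hasClique-∷ {x = x} {zs = zs} p a (q , r , p′ , refl , cl) =
    x ∷ q , r ++ zs
    , ↭-trans p (↭-prep x (↭-trans (++⁺ʳ zs p′) (↭-++-assoc q r zs)))
    , refl , All.++⁻ˡ q (All-resp-↭ p′ a) ∷ cl

  -- The indicator of colour `opp k`, so that `degree k` counts neighbours in colour `opp k`.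
  δ : Fin 2 → V → V → ℕ
  δ k x y = [ const 0 , const 1 ]′ (same-or-opp k (c x y))

  δ-sym : ∀ k x y → δ k x y ≡ δ k y x
  δ-sym k x y = cong ([ const 0 , const 1 ]′ ∘ same-or-opp k) (c-sym x y)

  degree : Fin 2 → V → List V → ℕ
  degree k x ys = sum (map (δ k x) ys)

  neighbours : ∀ k x ys → ∃₂ λ as bs → ys ↭ as ++ bs × All (Mono k x) as ×
               All (Mono (opp k) x) bs × length bs ≡ degree k x ys
  neighbours k x []       = [] , [] , ↭-refl , [] , [] , refl
  neighbours k x (y ∷ ys) with same-or-opp k (c x y) | neighbours k x ys
  ... | inj₁ e | as , bs , p , a , b , l = y ∷ as , bs , ↭-prep y p , e ∷ a , b , l
  ... | inj₂ e | as , bs , p , a , b , l =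
        as , y ∷ bs , ↭-trans (↭-prep y p) (↭-sym (shift y as bs)) , a , e ∷ b , cong suc l

  degree-↭ : ∀ k x {ys zs} → ys ↭ zs → degree k x ys ≡ degree k x zs
  degree-↭ k x p = sum-↭ (↭-map⁺ (δ k x) p)

  diagonal : Fin 2 → List V → ℕ
  diagonal k xs = sum (map (λ x → δ k x x) xs)

  degrees : Fin 2 → List V → List V → ℕ
  degrees k xs zs = sum (map (λ x → degree k x zs) xs)

  degrees-∷ʳ : ∀ k x xs zs → degrees k xs (x ∷ zs) ≡ degree k x xs + degrees k xs zs
  degrees-∷ʳ k x []       zs = refl
  degrees-∷ʳ k x (y ∷ ys) zs rewrite degrees-∷ʳ k x ys zs | δ-sym k y x =
    arith (δ k x y) (degree k y zs) (degree k x ys) (degrees k ys zs)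
    where
    arith : ∀ a b c d → a + b + (c + d) ≡ a + c + (b + d)
    arith = solve-∀

  -- The handshake lemma: a new vertex contributes its row and its column, equal by symmetry, and
  -- one diagonal entry.
  degrees-even : ∀ k xs → ∃ λ e → degrees k xs xs ≡ diagonal k xs + (e + e)
  degrees-even k []       = 0 , refl
  degrees-even k (x ∷ xs) with degrees-even k xs
  ... | e , eq = degree k x xs + e
      , trans (cong (degree k x (x ∷ xs) +_) (trans (degrees-∷ʳ k x xs xs) (cong (degree k x xs +_) eq)))
              (arith (δ k x x) (degree k x xs) (diagonal k xs) e)
    where
    arith : ∀ a b c d → a + b + (b + (c + (d + d))) ≡ a + c + (b + d + (b + d))
    arith = solve-∀

  degrees-regular : ∀ k d xs zs → All (λ x → degree k x zs ≡ d + δ k x x) xs →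
                    degrees k xs zs ≡ length xs * d + diagonal k xs
  degrees-regular k d []       zs []       = refl
  degrees-regular k d (x ∷ xs) zs (e ∷ es) rewrite e | degrees-regular k d xs zs es =
    arith d (δ k x x) (length xs * d) (diagonal k xs)
    where
    arith : ∀ a b c d → a + b + (c + d) ≡ a + c + (b + d)
    arith = solve-∀

  -- The Ramsey bound R(a,b) ≤ p, with the cliques of size `a` in colour `k`.
  Arrow : Fin 2 → ℕ → ℕ → ℕ → Set
  Arrow k p a b = ∀ xs → p ≤ length xs → HasClique k a xs ⊎ HasClique (opp k) b xs

  arrow-1ˡ : ∀ {k} b → Arrow k 1 1 b
  arrow-1ˡ b (x ∷ xs) _ = inj₁ (x ∷ [] , xs , ↭-refl , refl , [] ∷ [])

  arrow-1ʳ : ∀ {k} a → Arrow k 1 a 1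
  arrow-1ʳ a (x ∷ xs) _ = inj₂ (x ∷ [] , xs , ↭-refl , refl , [] ∷ [])

  arrow-swap : ∀ {k p a b} → (∀ j → Arrow j p a b) → Arrow k p b a
  arrow-swap {k} {a = a} f xs le with f (opp k) xs le
  ... | inj₁ h = inj₂ h
  ... | inj₂ h = inj₁ (subst (λ j → HasClique j _ xs) (opp-involutive k) h)

  module _ {k p q a b} (A : Arrow k p a (suc b)) (B : Arrow k q (suc a) b) where

    -- `x` extends every clique of colour `k` in `as` and every clique of colour `opp k` in `bs`; a
    -- clique of the other colour is already large enough.
    arrow-nbrs : ∀ {x xs as bs} → xs ↭ x ∷ as ++ bs → All (Mono k x) as → All (Mono (opp k) x) bs →
                 p ≤ length as ⊎ q ≤ length bs →
                 HasClique k (suc a) xs ⊎ HasClique (opp k) (suc b) xs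
    arrow-nbrs {x} {xs} {as} {bs} π α β (inj₁ le) =
      Sum.map (hasClique-∷ π α) (hasClique-⊇ (↭-trans π (↭-sym (shift x as bs)))) (A as le)
    arrow-nbrs {x} {xs} {as} {bs} π α β (inj₂ le) =
      Sum.map (hasClique-⊇ π′) (hasClique-∷ (↭-trans π (↭-prep x (↭-++-comm as bs))) β) (B bs le)
      where
      π′ : xs ↭ bs ++ x ∷ as
      π′ = ↭-trans π (↭-trans (↭-prep x (↭-++-comm as bs)) (↭-sym (shift x bs as)))

  -- The Erdős-Szekeres recursion: besides `x` there are at least p + q + 1 vertices, hence more
  -- than `p` neighbours in colour `k` or more than `q` in colour `opp k`.
  arrow-step : ∀ {k p q a b} → Arrow k (suc p) a (suc b) → Arrow k (suc q) (suc a) b →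
               Arrow k (suc p + suc q) (suc a) (suc b)
  arrow-step {k} {p} {q} A B (x ∷ xs) (s≤s le) with neighbours k x xs
  ... | as , bs , π , α , β , _ = arrow-nbrs A B (↭-prep x π) α β
        (either-large (length as) (length bs) (≤-trans (≤-reflexive (sym (+-suc p q)))
          (≤-trans le (≤-reflexive (trans (↭-length π) (length-++ as))))))

  arrow-⟨2,_⟩ : ∀ {k} b → Arrow k (suc b) 2 (suc b)
  arrow-⟨2, zero ⟩  = arrow-1ʳ 2
  arrow-⟨2, suc b ⟩ = arrow-step (arrow-1ˡ (2 + b)) arrow-⟨2, b ⟩

  arrow-⟨_,2⟩ : ∀ {k} a → Arrow k (suc a) (suc a) 2
  arrow-⟨ a ,2⟩ = arrow-swap (λ _ → arrow-⟨2, a ⟩)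

  arrow-⟨3,3⟩ : ∀ {k} → Arrow k 6 3 3
  arrow-⟨3,3⟩ = arrow-step arrow-⟨2, 2 ⟩ arrow-⟨ 2 ,2⟩

  -- If no clique appears at any of nine vertices, the second colour is 3-regular
  -- on them, which the handshake lemma forbids.  Entries of the diagonal of c are
  -- arbitrary, so they are carried along and cancelled.
  arrow-⟨4,3⟩-nine : ∀ {k} xs → length xs ≡ 9 → HasClique k 4 xs ⊎ HasClique (opp k) 3 xs
  arrow-⟨4,3⟩-nine {k} xs len with all-or xs cubic-at
    where
    cubic-at : ∀ {x} → x ∈ xs → (HasClique k 4 xs ⊎ HasClique (opp k) 3 xs) ⊎
                              degree k x xs ≡ 3 + δ k x x
    cubic-at {x} x∈ with ∈-∃++ x∈
    ... | ys , zs , refl with neighbours k x (ys ++ zs)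
    -- Of the other eight vertices, six joined to `x` in colour `k` suffice by R(3,3) ≤ 6, and four
    -- in colour `opp k` by R(4,2) ≤ 4. Otherwise exactly three are joined in `opp k`.
    ... | as , bs , π , α , β , l with either-large {5} {2} (length as) (length bs)
                                          (≤-reflexive (suc-injective (trans (sym len) total)))
      where
      total : length xs ≡ suc (length as + length bs)
      total = trans (↭-length (shift x ys zs)) (cong suc (trans (↭-length π) (length-++ as)))
    ... | inj₁ big = inj₁ (arrow-nbrs arrow-⟨3,3⟩ (arrow-⟨ 3 ,2⟩)
                         (↭-trans (shift x ys zs) (↭-prep x π)) α β (inj₁ big))
    ... | inj₂ 3≤ with 4 ≤? length bs
    ... | yes big = inj₁ (arrow-nbrs arrow-⟨3,3⟩ (arrow-⟨ 3 ,2⟩)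
                         (↭-trans (shift x ys zs) (↭-prep x π)) α β (inj₂ big))
    ... | no ¬4≤ = inj₂ (trans (degree-↭ k x (shift x ys zs)) (trans (+-comm (δ k x x) _)
                     (cong (_+ δ k x x) (trans (sym l) (≤-antisym (≤-pred (≰⇒> ¬4≤)) 3≤)))))
  ... | inj₁ h     = h
  ... | inj₂ cubic with degrees-even k xs
  ... | e , eq = ⊥-elim (odd e (+-cancelˡ-≡ (diagonal k xs) (e + e) 27
          (trans (sym eq) (trans (degrees-regular k 3 xs xs cubic)
            (trans (cong (λ t → t * 3 + diagonal k xs) len) (+-comm 27 _))))))
    where
    odd : ∀ e → e + e ≢ 27
    odd e p with e ≤? 13
    ... | yes l = contradiction (≤-trans (≤-reflexive (sym p)) (+-mono-≤ l l)) (<⇒≱ ≤-refl)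
    ... | no l  = contradiction (≤-trans (+-mono-≤ (≰⇒> l) (≰⇒> l)) (≤-reflexive p)) (<⇒≱ ≤-refl)

  arrow-⟨4,3⟩ : ∀ {k} → Arrow k 9 4 3
  arrow-⟨4,3⟩ {k} xs le =
    Sum.map (hasClique-⊇ split) (hasClique-⊇ split)
      (arrow-⟨4,3⟩-nine (take 9 xs) (trans (length-take 9 xs) (m≤n⇒m⊓n≡m le)))
    where
    split : xs ↭ take 9 xs ++ drop 9 xs
    split = ↭-reflexive (sym (take++drop≡id 9 xs))

  arrow-⟨4,4⟩ : ∀ {k} → Arrow k 18 4 4
  arrow-⟨4,4⟩ = arrow-step (arrow-swap (λ _ → arrow-⟨4,3⟩)) arrow-⟨4,3⟩

  -- Packings of disjoint cliques.

  -- The leftover `r` is an index, so that one packing can start where another one stops.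
  data Pack (P : List V → Set) : ℕ → List V → List V → Set where
    done : ∀ {xs r} → xs ↭ r → Pack P 0 xs r
    more : ∀ {t xs q ys r} → xs ↭ q ++ ys → P q → Pack P t ys r → Pack P (suc t) xs r

  Packed : (List V → Set) → ℕ → List V → Set
  Packed P t xs = ∃ (Pack P t xs)

  module _ {P : List V → Set} where

    pack-↭ : ∀ {t xs ys r} → xs ↭ ys → Pack P t ys r → Pack P t xs r
    pack-↭ π (done π′)     = done (↭-trans π π′)
    pack-↭ π (more π′ b p) = more (↭-trans π π′) b p

    pack-++ : ∀ {t xs r} zs → Pack P t xs r → Pack P t (xs ++ zs) (r ++ zs)
    pack-++ zs (done π) = done (++⁺ʳ zs π)
    pack-++ zs (more {q = q} {ys} π b p) =
      more (↭-trans (++⁺ʳ zs π) (↭-++-assoc q ys zs)) b (pack-++ zs p)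

    pack-⊇ : ∀ {t xs ys r zs} → xs ↭ ys ++ zs → Pack P t ys r → Pack P t xs (r ++ zs)
    pack-⊇ {zs = zs} π p = pack-↭ π (pack-++ zs p)

    packed-⊇ : ∀ {t xs ys zs} → xs ↭ ys ++ zs → Packed P t ys → Packed P t xs
    packed-⊇ π (_ , p) = _ , pack-⊇ π p

    pack-seq : ∀ {s t xs r r′} → Pack P s xs r → Pack P t r r′ → Pack P (s + t) xs r′
    pack-seq (done π)     p′ = pack-↭ π p′
    pack-seq (more π b p) p′ = more π b (pack-seq p p′)

    pack-snoc : ∀ {t xs q r r′} → Pack P t xs r → r ↭ q ++ r′ → P q → Pack P (suc t) xs r′
    pack-snoc (done π)     π′ b = more (↭-trans π π′) b (done ↭-refl)
    pack-snoc (more π a p) π′ b = more π a (pack-snoc p π′ b)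

    pack-truncate : ∀ {s t xs r} → s ≤ t → Pack P t xs r → Packed P s xs
    pack-truncate z≤n      p            = _ , done ↭-refl
    pack-truncate (s≤s le) (more π b p) = _ , more π b (proj₂ (pack-truncate le p))

    -- Isolates the covered vertices `zs`, so that the leftover can be used first and the blocks
    -- later.
    pack-rest : ∀ {t xs r} → Pack P t xs r → ∃ λ zs → xs ↭ r ++ zs × Pack P t zs []
    pack-rest (done π) = [] , ↭-trans π (↭-sym (↭-++-identityʳ _)) , done ↭-refl
    pack-rest {r = r} (more {q = q} π b p) with pack-rest p
    ... | zs , π′ , p′ = q ++ zs , ↭-trans π (↭-trans (++⁺ˡ q π′)
          (solve↭ 3 (λ q r z → q ⊕ (r ⊕ z) ⊜ r ⊕ (q ⊕ z)) ↭-refl q r zs)) , more ↭-refl b p′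

    pack-length : ∀ {m t xs r} → (∀ {q} → P q → length q ≡ m) → Pack P t xs r →
                  length xs ≡ t * m + length r
    pack-length f (done π) = ↭-length π
    pack-length {m} f (more {t} {q = q} π b p) = trans (↭-length π) (trans (length-++ q)
      (trans (cong₂ _+_ (f b) (pack-length f p)) (sym (+-assoc m (t * m) _))))

    pack-All : ∀ {Q : V → Set} {t xs r} → All Q xs → Pack P t xs r →
               Pack (λ q → P q × All Q q) t xs r
    pack-All α (done π) = done π
    pack-All α (more {q = q} π b p) with All.++⁻ q (All-resp-↭ π α)
    ... | β , γ = more π (b , β) (pack-All γ p)

  rest-∈ : ∀ {P t xs r x} → Pack P t xs r → x ∈ r → x ∈ xs
  rest-∈ p x∈ with pack-rest p
  ... | _ , π , _ = ∈-resp-↭ (↭-sym π) (∈-++⁺ˡ x∈)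

  Cross : Fin 2 → List V → List V → Set
  Cross k X Y = ∀ {x y} → x ∈ X → y ∈ Y → Mono k x y

  clique-++ : ∀ {k a b p q} → Cross k p q → Clique k a p → Clique k b q → Clique k (a + b) (p ++ q)
  clique-++ {p = p} {q} cr (refl , α) (refl , β) =
    length-++ p , AllPairs.++⁺ α β (All.tabulate (λ x∈ → All.tabulate (λ y∈ → cr x∈ y∈)))

  -- All edges between `X` and `Y` have colour `k`, so the blocks of the two packings can be united
  -- in pairs.
  pack-join : ∀ {k a b t X X′ Y Y′} → Cross k X Y →
              Pack (Clique k a) t X X′ → Pack (Clique k b) t Y Y′ →
              Pack (Clique k (a + b)) t (X ++ Y) (X′ ++ Y′)
  pack-join cr (done π) (done π′) = done (++⁺ π π′)
  pack-join cr (more {q = q} {X₁} π b p) (more {q = q′} {Y₁} π′ b′ p′) =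
    more (↭-trans (++⁺ π π′) (solve↭ 4 (λ q x r y → (q ⊕ x) ⊕ (r ⊕ y) ⊜ (q ⊕ r) ⊕ (x ⊕ y)) ↭-refl q X₁ q′ Y₁))
         (clique-++ (λ x∈ y∈ → cr (back π (∈-++⁺ˡ x∈)) (back π′ (∈-++⁺ˡ y∈))) b b′)
         (pack-join (λ x∈ y∈ → cr (back π (∈-++⁺ʳ q x∈)) (back π′ (∈-++⁺ʳ q′ y∈))) p p′)
    where
    back : ∀ {x : V} {xs ys} → xs ↭ ys → x ∈ ys → x ∈ xs
    back π = ∈-resp-↭ (↭-sym π)

  pack-singletons : ∀ {k} t xs → t ≤ length xs → Packed (Clique k 1) t xs
  pack-singletons zero    xs       _        = xs , done ↭-refl
  pack-singletons (suc t) (x ∷ xs) (s≤s le) with pack-singletons t xs le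
  ... | r , p = r , more ↭-refl (refl , [] ∷ []) p

  -- The extra clique may have its own size: a smaller last clique needs fewer vertices, which
  -- matters for small `n`.
  PackPlus : Fin 2 → ℕ → ℕ → ℕ → List V → Set
  PackPlus k m t j xs = ∃ λ r → Pack (Clique k m) t xs r × HasClique k j r

  packPlus-⊇ : ∀ {k m t j xs ys zs} → xs ↭ ys ++ zs → PackPlus k m t j ys → PackPlus k m t j xs
  packPlus-⊇ π (r , p , h) = _ , pack-⊇ π p , hasClique-⊇ ↭-refl h

  packPlus-join : ∀ {k a b t i j X Y} → Cross k X Y → a + b ≡ i + j →
                  PackPlus k a t i X → PackPlus k b t j Y → Packed (Clique k (a + b)) (suc t) (X ++ Y)
  packPlus-join {k} {X = X} {Y} cr e (r , p , q , s , π , cl) (r′ , p′ , q′ , s′ , π′ , cl′) =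
    s ++ s′ , pack-snoc (pack-join cr p p′)
      (↭-trans (++⁺ π π′) (solve↭ 4 (λ q x r y → (q ⊕ x) ⊕ (r ⊕ y) ⊜ (q ⊕ r) ⊕ (x ⊕ y)) ↭-refl q s q′ s′))
      (subst (λ i → Clique k i (q ++ q′)) (sym e)
        (clique-++ (λ x∈ y∈ → cr (rest-∈ p (∈-resp-↭ (↭-sym π) (∈-++⁺ˡ x∈)))
                                 (rest-∈ p′ (∈-resp-↭ (↭-sym π′) (∈-++⁺ˡ y∈)))) cl cl′))

  -- The size hypothesis is |xs| ≥ L + (t - 1)m without subtraction: at least `L` vertices are
  -- present before each of the `t` removals. `A` is an alternative outcome that passes to
  -- supersets.
  greedy : ∀ {A : List V → Set} {k m L} → (∀ {xs ys zs} → xs ↭ ys ++ zs → A ys → A xs) →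
           (∀ ys → L ≤ length ys → A ys ⊎ HasClique k m ys) →
           ∀ t xs → L + t * m ≤ m + length xs → A xs ⊎ Packed (Clique k m) t xs
  greedy up find zero    xs le = inj₂ (xs , done ↭-refl)
  greedy {m = m} {L} up find (suc t) xs le with find xs (greedy-find L m t (length xs) le)
  ... | inj₁ a = inj₁ a
  ... | inj₂ (q , ys , π , cl@(|q| , _)) with greedy up find t ys
          (greedy-rest L m t (length xs) (length ys) (trans (↭-length π) (trans (length-++ q) (cong (_+ length ys) |q|))) le)
  ... | inj₁ a       = inj₁ (up (↭-trans π (↭-++-comm q ys)) a)
  ... | inj₂ (r , p) = inj₂ (r , more π cl p)

  -- Two nested greedy searches. Among any `L` vertices, the inner one removes cliques of colour
  -- `opp k` until the `PackPlus` is complete or a K4 of colour `k` turns up; the outer one collects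
  -- `n` such K4s.
  K4s-or-packPlus : ∀ {k p p′ m t j L n xs} → Arrow k p 4 m → Arrow k p′ 4 j →
                    p + t * m ≤ m + L → p′ + t * m ≤ L → L + n * 4 ≤ 4 + length xs →
                    Packed (Clique k 4) n xs ⊎ PackPlus (opp k) m t j xs
  K4s-or-packPlus {k} {p} {p′} {m} {t} {j} {L} {n} {xs} A A′ le le′ =
    Sum.swap ∘ greedy packPlus-⊇ find n xs
    where
    find : ∀ ys → L ≤ length ys → PackPlus (opp k) m t j ys ⊎ HasClique k 4 ys
    find ys L≤ with greedy hasClique-⊇ A t ys (≤-trans le (+-monoʳ-≤ m L≤))
    ... | inj₁ h = inj₂ h
    ... | inj₂ (r , pk) with A′ r (+-cancelˡ-≤ (t * m) p′ (length r)
                                    (≤-trans (≤-reflexive (+-comm (t * m) p′))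
                                      (≤-trans le′ (≤-trans L≤ (≤-reflexive (pack-length proj₁ pk))))))
    ... | inj₁ h = inj₂ (hasClique-⊇ (proj₁ (proj₂ (pack-rest pk))) h)
    ... | inj₂ h = inj₁ (r , pk , h)

  -- Matchings and K4s in one component.

  Reach : Fin 2 → V → V → Set
  Reach k = Star (Mono k)

  ConnectedK4 : Fin 2 → V → List V → Set
  ConnectedK4 k w q = Clique k 4 q × All (Reach k w) q

  ConnectedK4s : Fin 2 → ℕ → List V → Set
  ConnectedK4s k n xs = ∃ λ w → Packed (ConnectedK4 k w) n xs

  connectedK4s-⊇ : ∀ {k n xs ys zs} → xs ↭ ys ++ zs → ConnectedK4s k n ys → ConnectedK4s k n xs
  connectedK4s-⊇ π (w , p) = w , packed-⊇ π p

  clique-packed : ∀ {k w} t U → AllPairs (Mono k) U → All (Reach k w) U → t * 4 ≤ length U →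
                  Packed (ConnectedK4 k w) t U
  clique-packed zero    U _ _ _ = U , done ↭-refl
  clique-packed (suc t) (a ∷ b ∷ c ∷ d ∷ U) α@(_ ∷ _ ∷ _ ∷ _ ∷ α′) (ra ∷ rb ∷ rc ∷ rd ∷ ρ) (s≤s (s≤s (s≤s (s≤s le))))
    with clique-packed t U α′ ρ le
  ... | r , p = r , more ↭-refl ((refl , AllPairs-++⁻ˡ (a ∷ b ∷ c ∷ d ∷ []) α) , ra ∷ rb ∷ rc ∷ rd ∷ []) p

  mono-or-edge : ∀ k U → AllPairs (Mono k) U ⊎ HasClique (opp k) 2 U
  mono-or-edge k []      = inj₁ []
  mono-or-edge k (x ∷ U) with mono-or-edge k U | neighbours k x U
  ... | inj₂ h | _ = inj₂ (hasClique-⊇ (↭-++-comm (x ∷ []) U) h)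
  ... | inj₁ α | as , [] , π , β , _ = inj₁ (All-resp-↭ (↭-sym (↭-trans π (↭-++-identityʳ as))) β ∷ α)
  ... | inj₁ _ | as , y ∷ bs , π , _ , e ∷ _ , _ =
        inj₂ (x ∷ y ∷ [] , as ++ bs , ↭-prep x (↭-trans π (shift y as bs)) , refl , (e ∷ []) ∷ [] ∷ [])

  -- A matching edge neither of whose endpoints completes a K4 with three fresh vertices
  -- of U lies on an augmenting path of length three.
  exchange : ∀ {k w m D U} → Pack (Clique (opp k) 2) m D U →
             AllPairs (Mono k) U → All (Reach k w) U → m * 3 < length U →
             (∃₂ λ U′ I → ∃ λ J → Pack (ConnectedK4 k w) m D (U′ ++ J) × U ↭ U′ ++ I ×
                length U ≡ length U′ + m * 3)
             ⊎ Packed (Clique (opp k) 2) (suc m) D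
  exchange {D = D} {U} (done π) α ρ _ =
    inj₁ (U , [] , [] , done (↭-trans π (↭-sym (↭-++-identityʳ U))) , ↭-sym (↭-++-identityʳ U) , sym (+-identityʳ _))
  exchange {k} {w} {suc m} {D} {U} (more {q = u ∷ v ∷ []} {D₁} π cl p) α ρ lt
    with exchange p α ρ (≤-trans (s≤s (m≤n+m (m * 3) 3)) lt)
  ... | inj₂ (r , p′) = inj₂ (r , more π cl p′)
  -- `I` holds the vertices of `U` already spent, three for each treated edge, and `J` the discarded
  -- endpoints. The matching `p` is kept, since an augmentation changes `p` and not `p′`.
  ... | inj₁ (U′ , I , J , p′ , π′ , len) = try (neighbours k u U′)
    where
    Result : Set
    Result = (∃₂ λ U′ I → ∃ λ J → Pack (ConnectedK4 k w) (suc m) D (U′ ++ J) × U ↭ U′ ++ I ×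
                length U ≡ length U′ + (3 + m * 3))
             ⊎ Packed (Clique (opp k) 2) (2 + m) D

    4≤U′ : 4 ≤ length U′
    4≤U′ = +-cancelʳ-≤ (m * 3) 4 (length U′) (≤-trans lt (≤-reflexive len))

    K4-with : ∀ z z′ Z E → D ↭ z ∷ z′ ∷ D₁ → U′ ↭ Z ++ E → All (Mono k z) Z → 3 ≤ length Z → Result
    K4-with z z′ (x ∷ y ∷ t ∷ Z) E σ τ (zx ∷ zy ∷ zt ∷ _) _ =
      inj₁ (Z ++ E , x ∷ y ∷ t ∷ I , z′ ∷ J
        , pack-snoc {q = z ∷ x ∷ y ∷ t ∷ []} (pack-⊇ (↭-trans σ (↭-++-comm (z ∷ z′ ∷ []) D₁)) p′)
            (↭-trans (++⁺ʳ (z ∷ z′ ∷ []) (++⁺ʳ J τ))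
              (solve↭ 6 (λ a b z e j b′ → (((a ⊕ z) ⊕ e) ⊕ j) ⊕ (b ⊕ b′) ⊜ (b ⊕ a) ⊕ ((z ⊕ e) ⊕ (b′ ⊕ j)))
                ↭-refl (x ∷ y ∷ t ∷ []) (z ∷ []) Z E J (z′ ∷ [])))
            ((refl , (zx ∷ zy ∷ zt ∷ []) ∷ AllPairs-++⁻ˡ (x ∷ y ∷ t ∷ [])
                (AllPairs-mono-resp-↭ (↭-trans π′ (++⁺ʳ I τ)) α))
              , (rx ▻▻ mono-sym zx) ∷ rx ∷ ry ∷ rt ∷ [])
        , ↭-trans π′ (↭-trans (++⁺ʳ I τ) (solve↭ 4 (λ a z e i → (a ⊕ z ⊕ e) ⊕ i ⊜ (z ⊕ e) ⊕ (a ⊕ i))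
                ↭-refl (x ∷ y ∷ t ∷ []) Z E I))
        , trans len (trans (cong (_+ m * 3) (↭-length τ)) (arith (length (Z ++ E)) (m * 3))))
      where
      _▻▻_ : ∀ {x y} → Reach k w x → Mono k x y → Reach k w y
      r ▻▻ e = r ◅◅ (e ◅ ε)
      ρ′ : All (Reach k w) ((x ∷ y ∷ t ∷ Z) ++ E)
      ρ′ = All-resp-↭ τ (All.++⁻ˡ U′ (All-resp-↭ π′ ρ))
      rx = All.lookup ρ′ (here refl)
      ry = All.lookup ρ′ (there (here refl))
      rt = All.lookup ρ′ (there (there (here refl)))
      arith : ∀ a b → 3 + a + b ≡ a + (3 + b)
      arith = solve-∀

    K4-with _ _ (_ ∷ [])     _ _ _ _ (s≤s ())
    K4-with _ _ (_ ∷ _ ∷ []) _ _ _ _ (s≤s (s≤s ()))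

    try : (∃₂ λ as bs → U′ ↭ as ++ bs × All (Mono k u) as × All (Mono (opp k) u) bs × _) → Result
    try (as , [] , τ , β , _) = K4-with u v as [] π τ β
      (≤-trans (n≤1+n 3) (≤-trans 4≤U′ (≤-reflexive (↭-length (↭-trans τ (↭-++-identityʳ as))))))
    -- Testing `v` against the vertices other than `x` makes the new edges, from `u` to `x` and from
    -- `v` to `y`, disjoint. At least three vertices remain for a K4 at `v`.
    try (as , x ∷ bs , τ , _ , ux ∷ _ , _) with neighbours k v (as ++ bs)
    ... | cs , [] , τ′ , γ , _ = K4-with v u cs (x ∷ [])
            (↭-trans π (↭-swap u v ↭-refl))
            (↭-trans U′↭ (↭-++-comm (x ∷ []) cs)) γ
            (≤-pred (≤-trans 4≤U′ (≤-reflexive (↭-length U′↭))))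
      where
      U′↭ : U′ ↭ x ∷ cs
      U′↭ = ↭-trans τ (↭-trans (shift x as bs) (↭-prep x (↭-trans τ′ (↭-++-identityʳ cs))))
    ... | cs , y ∷ ds , τ′ , _ , vy ∷ _ , _ =
      inj₂ (_ , pack-snoc {q = v ∷ y ∷ []} (pack-snoc {q = u ∷ x ∷ []} (pack-⊇ (↭-trans π (↭-++-comm (u ∷ v ∷ []) D₁)) p)
        (↭-trans (++⁺ʳ (u ∷ v ∷ []) (↭-trans π′ (++⁺ʳ I U′↭)))
          (solve↭ 6 (λ x y r i u v → ((x ⊕ y ⊕ r) ⊕ i) ⊕ u ⊕ v ⊜ (u ⊕ x) ⊕ (v ⊕ y) ⊕ r ⊕ i)
            ↭-refl (x ∷ []) (y ∷ []) (cs ++ ds) I (u ∷ []) (v ∷ [])))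
        (refl , (ux ∷ []) ∷ [] ∷ [])) ↭-refl (refl , (vy ∷ []) ∷ [] ∷ []))
      where
      U′↭ : U′ ↭ x ∷ y ∷ cs ++ ds
      U′↭ = ↭-trans τ (↭-trans (shift x as bs) (↭-prep x (↭-trans τ′ (shift y cs ds))))
  exchange (more {q = []} _ (() , _) _)
  exchange (more {q = _ ∷ []} _ (() , _) _)
  exchange (more {q = _ ∷ _ ∷ _ ∷ _} _ (() , _) _)

  Matching : Fin 2 → ℕ → List V → Set
  Matching k n D = ∃ λ m → m ≤ n × Packed (Clique k 2) m D × (m ≡ n ⊎ length D < n * 4 + m)

  -- If m < n and |D| ≥ 4n + m, then at least 4(n - m) + 3m vertices are uncovered. When these form
  -- a clique of colour `k`, `exchange` augments the matching or makes `m` K4s from 3m of them, and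
  -- the other 4(n - m) give n - m more. Each K4 meets that clique, so all lie in one component.
  matching : ∀ k n D → ConnectedK4s k n D ⊎ Matching (opp k) n D
  matching k n D = extend n 0 (+-comm n 0) (D , done ↭-refl)
    where
    extend : ∀ s m → s + m ≡ n → Packed (Clique (opp k) 2) m D → ConnectedK4s k n D ⊎ Matching (opp k) n D
    extend zero    m e p = inj₂ (m , ≤-reflexive e , p , inj₁ e)
    extend (suc s) m e p with length D <? n * 4 + m
    ... | yes lt = inj₂ (m , ≤-trans (m≤n+m m (suc s)) (≤-reflexive e) , p , inj₂ lt)
    ... | no ¬lt with p
    ... | U , q with mono-or-edge k U
    ... | inj₂ (_ , r , π , cl) = extend s (suc m) (trans (+-suc s m) e) (r , pack-snoc q π cl)
    ... | inj₁ α = finish U q α (uncovered-large s m n (length U) (length D) e (pack-length proj₁ q) (≮⇒≥ ¬lt))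
      where
      finish : ∀ U → Pack (Clique (opp k) 2) m D U → AllPairs (Mono k) U → suc s * 4 + m * 3 ≤ length U →
               ConnectedK4s k n D ⊎ Matching (opp k) n D
      finish (w ∷ U) q α@(a ∷ _) big
        with exchange {w = w} q α (ε ∷ All.map (_◅ ε) a) (≤-trans (s≤s (m≤n+m (m * 3) (3 + s * 4))) big)
      ... | inj₂ p′ = extend s (suc m) (trans (+-suc s m) e) p′
      ... | inj₁ (U′ , I , J , p′ , π , len) =
            inj₁ (w , subst (λ i → Packed (ConnectedK4 k w) i D) (trans (+-comm m (suc s)) e)
              (_ , pack-seq p′ (pack-⊇ ↭-refl (proj₂ (clique-packed (suc s) U′
                (AllPairs-++⁻ˡ U′ (AllPairs-mono-resp-↭ π α))
                (All.++⁻ˡ U′ (All-resp-↭ π (ε ∷ All.map (_◅ ε) a)))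
                (+-cancelʳ-≤ (m * 3) _ _ (≤-trans big (≤-reflexive len))))))))

  -- Joining packings across two or three parts.

  -- Empty cliques let one side of a join contribute nothing to most of the K4s.
  pack-empty : ∀ {k} t xs → Pack (Clique k 0) t xs xs
  pack-empty zero    xs = done ↭-refl
  pack-empty (suc t) xs = more ↭-refl (refl , []) (pack-empty t xs)

  -- The singletons come from the leftover of `p` but are taken first, so a part can postpone its
  -- edges to a later round.
  singletons-first : ∀ {k P s xs r} t → Pack P s xs r → t ≤ length r →
    ∃₂ λ r′ r″ → Pack (Clique k 1) t xs r′ × Pack P s r′ r″ × length r ≡ t + length r″
  singletons-first {r = r} t p le with pack-rest p | pack-singletons t r le
  ... | zs , π , p′ | r″ , q = r″ ++ zs , r″ , pack-⊇ π q , pack-⊇ (↭-++-comm r″ zs) p′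
        , trans (pack-length proj₁ q) (cong (_+ length r″) (*-identityʳ t))

  pack-join₃ : ∀ {k a b d t X X′ Y Y′ Z Z′} → Cross k X Y → Cross k X Z → Cross k Y Z →
               Pack (Clique k a) t X X′ → Pack (Clique k b) t Y Y′ → Pack (Clique k d) t Z Z′ →
               Pack (Clique k (a + (b + d))) t (X ++ (Y ++ Z)) (X′ ++ (Y′ ++ Z′))
  pack-join₃ {Y = Y} xy xz yz p q r =
    pack-join (λ x∈ u∈ → [ xy x∈ , xz x∈ ]′ (∈-++⁻ Y u∈)) p (pack-join yz q r)

  -- Three rounds: in each, one part supplies edges and the other two supply single vertices. A part
  -- supplying `e` edges needs 2e + (n - e) = n + e ≤ 2n vertices.
  three-matchings : ∀ {k n X Y Z} e₁ e₂ e₃ → e₁ + (e₂ + e₃) ≡ n →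
    Cross k X Y → Cross k X Z → Cross k Y Z →
    n * 2 ≤ length X → n * 2 ≤ length Y → n * 2 ≤ length Z →
    Packed (Clique k 2) e₁ X → Packed (Clique k 2) e₂ Y → Packed (Clique k 2) e₃ Z →
    Packed (Clique k 4) n (X ++ (Y ++ Z))
  three-matchings {k} {n} {X} {Y} {Z} e₁ e₂ e₃ e xy xz yz lX lY lZ (X₁ , p) (_ , q) (_ , r) =
    subst (λ i → Packed (Clique k 4) i (X ++ (Y ++ Z))) e
      (_ , pack-seq (pack-join₃ xy xz yz p q₁ r₁)
        (pack-seq (pack-join₃ (λ x∈ y∈ → xy (rest-∈ p x∈) (rest-∈ q₁ y∈))
                              (λ x∈ z∈ → xz (rest-∈ p x∈) (rest-∈ r₁ z∈))
                              (λ y∈ z∈ → yz (rest-∈ q₁ y∈) (rest-∈ r₁ z∈)) p₂ q₂ r₂)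
                  (pack-join₃ (λ x∈ y∈ → xy (rest-∈ p (rest-∈ p₂ x∈)) (rest-∈ q₁ (rest-∈ q₂ y∈)))
                              (λ x∈ z∈ → xz (rest-∈ p (rest-∈ p₂ x∈)) (rest-∈ r₁ (rest-∈ r₂ z∈)))
                              (λ y∈ z∈ → yz (rest-∈ q₁ (rest-∈ q₂ y∈)) (rest-∈ r₁ (rest-∈ r₂ z∈)))
                              (proj₂ p₃) (proj₂ q₃) r₃)))
    where
    restX = rest-large n e₁ (e₂ + e₃) _ _ e lX (pack-length proj₁ p)
    restY = rest-large n e₂ (e₁ + e₃) _ _ (trans (arith e₂ e₁ e₃) e) lY (pack-length proj₁ q)
      where
      arith : ∀ a b c → a + (b + c) ≡ b + (a + c)
      arith = solve-∀
    restZ = rest-large n e₃ (e₁ + e₂) _ _ (trans (arith e₃ e₁ e₂) e) lZ (pack-length proj₁ r)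
      where
      arith : ∀ a b c → a + (b + c) ≡ b + (c + a)
      arith = solve-∀
    P₂ = pack-singletons {k} e₂ X₁ (≤-trans (m≤m+n e₂ e₃) restX)
    p₂ = proj₂ P₂
    p₃ = pack-singletons {k} e₃ (proj₁ P₂) (+-cancelˡ-≤ (e₂ * 1) _ _
           (≤-trans (≤-reflexive (cong (_+ e₃) (*-identityʳ e₂)))
             (≤-trans restX (≤-reflexive (pack-length proj₁ p₂)))))
    Q₁ = singletons-first {k} e₁ q (≤-trans (m≤m+n e₁ e₃) restY)
    q₁ = proj₁ (proj₂ (proj₂ Q₁))
    q₂ = proj₁ (proj₂ (proj₂ (proj₂ Q₁)))
    q₃ = pack-singletons {k} e₃ (proj₁ (proj₂ Q₁)) (+-cancelˡ-≤ e₁ _ _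
           (≤-trans restY (≤-reflexive (proj₂ (proj₂ (proj₂ (proj₂ Q₁)))))))
    R₁ = singletons-first {k} e₁ r (≤-trans (m≤m+n e₁ e₂) restZ)
    r₁ = proj₁ (proj₂ (proj₂ R₁))
    R₂ = singletons-first {k} e₂ (proj₁ (proj₂ (proj₂ (proj₂ R₁)))) (+-cancelˡ-≤ e₁ _ _
           (≤-trans restZ (≤-reflexive (proj₂ (proj₂ (proj₂ (proj₂ R₁)))))))
    r₂ = proj₁ (proj₂ (proj₂ R₂))
    r₃ = proj₁ (proj₂ (proj₂ (proj₂ R₂)))

  -- If no matching reaches size `n`, each part has at most 4n + mᵢ - 1 vertices. Comparing the sum
  -- with 13n - 3 gives m₁ + m₂ + m₃ ≥ n, without slack.
  three-parts : ∀ {k n X Y Z} → Cross (opp k) X Y → Cross (opp k) X Z → Cross (opp k) Y Z →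
    n * 2 ≤ length X → n * 2 ≤ length Y → n * 2 ≤ length Z →
    n * 13 ≤ 3 + (length X + (length Y + length Z)) →
    ConnectedK4s k n (X ++ (Y ++ Z)) ⊎ Packed (Clique (opp k) 4) n (X ++ (Y ++ Z))
  three-parts {k} {n} {X} {Y} {Z} xy xz yz lX lY lZ tot
    with matching k n X | matching k n Y | matching k n Z
  ... | inj₁ r | _ | _ = inj₁ (connectedK4s-⊇ ↭-refl r)
  ... | _ | inj₁ r | _ = inj₁ (connectedK4s-⊇
        (solve↭ 3 (λ x y z → x ⊕ (y ⊕ z) ⊜ y ⊕ (x ⊕ z)) ↭-refl X Y Z) r)
  ... | _ | _ | inj₁ r = inj₁ (connectedK4s-⊇
        (solve↭ 3 (λ x y z → x ⊕ (y ⊕ z) ⊜ z ⊕ (x ⊕ y)) ↭-refl X Y Z) r)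
  ... | inj₂ (m₁ , _ , (_ , p₁) , d₁) | inj₂ (m₂ , _ , (_ , p₂) , d₂) | inj₂ (m₃ , _ , (_ , p₃) , d₃)
    with split-bound m₁ (m₂ + m₃) (enough d₁ d₂ d₃)
    where
    enough : m₁ ≡ n ⊎ _ → m₂ ≡ n ⊎ _ → m₃ ≡ n ⊎ _ → n ≤ m₁ + (m₂ + m₃)
    enough (inj₁ refl) _ _ = m≤m+n m₁ _
    enough _ (inj₁ refl) _ = ≤-trans (m≤m+n m₂ m₃) (m≤n+m _ m₁)
    enough _ _ (inj₁ refl) = ≤-trans (m≤n+m m₃ m₂) (m≤n+m _ m₁)
    enough (inj₂ l₁) (inj₂ l₂) (inj₂ l₃) = matchings-large n _ _ _ m₁ m₂ m₃ tot l₁ l₂ l₃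
  ... | e₁ , f , e₁≤ , f≤ , eq with split-bound m₂ m₃ f≤
  ... | e₂ , e₃ , e₂≤ , e₃≤ , refl = inj₂ (three-matchings e₁ e₂ e₃ eq xy xz yz lX lY lZ
          (pack-truncate e₁≤ p₁) (pack-truncate e₂≤ p₂) (pack-truncate e₃≤ p₃))

  two-parts : ∀ {k X Y} n → Cross (opp k) X Y →
    (ConnectedK4s k n (X ++ Y) ⊎ Packed (Clique (opp k) 4) n (X ++ Y)) ⊎
    (length X < n * 5 ⊎ length Y < n * 5)
  two-parts {k} {X} {Y} n xy with matching k n X | matching k n Y
  ... | inj₁ r | _ = inj₁ (inj₁ (connectedK4s-⊇ ↭-refl r))
  ... | _ | inj₁ r = inj₁ (inj₁ (connectedK4s-⊇ (↭-++-comm X Y) r))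
  ... | inj₂ (m , m≤n , _ , inj₂ lt) | _ = inj₂ (inj₁ (matching-bound n m m≤n lt))
  ... | _ | inj₂ (m , m≤n , _ , inj₂ lt) = inj₂ (inj₂ (matching-bound n m m≤n lt))
  ... | inj₂ (_ , _ , (_ , p) , inj₁ refl) | inj₂ (_ , _ , (_ , q) , inj₁ refl) =
        inj₁ (inj₂ (_ , pack-join xy p q))

  -- Components and the disconnected case.

  cross-or-edge : ∀ k S T → (∃ λ x → ∃₂ λ y T′ → x ∈ S × T ↭ y ∷ T′ × Mono k x y) ⊎ Cross (opp k) S T
  cross-or-edge k []      T = inj₂ λ ()
  cross-or-edge k (x ∷ S) T with neighbours k x T
  ... | y ∷ as , bs , π , e ∷ _ , _ = inj₁ (x , y , as ++ bs , here refl , π , e)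
  ... | [] , bs , π , _ , β , _ with cross-or-edge k S T
  ... | inj₁ (z , y , T′ , z∈ , π′ , e) = inj₁ (z , y , T′ , there z∈ , π′ , e)
  ... | inj₂ cr = inj₂ λ { (here refl) y∈ → All.lookup β (∈-resp-↭ π y∈) ; (there x∈) y∈ → cr x∈ y∈ }

  Component : Fin 2 → V → List V → Set
  Component k v X = ∃₂ λ S T → X ↭ S ++ T × v ∈ S × All (Reach k v) S × Cross (opp k) S T

  component : ∀ k v X → Component k v (v ∷ X)
  component k v X = grow (length X) (v ∷ []) X ≤-refl (here refl) (ε ∷ [])
    where
    grow : ∀ f S T → length T ≤ f → v ∈ S → All (Reach k v) S → Component k v (S ++ T)
    grow f S T le v∈ ρ with cross-or-edge k S T
    grow f S T le v∈ ρ | inj₂ cr = S , T , ↭-refl , v∈ , ρ , cr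
    grow zero    S T le v∈ ρ | inj₁ (_ , _ , _ , _ , π , _) =
      contradiction (≤-trans (≤-reflexive (sym (↭-length π))) le) λ ()
    grow (suc f) S T le v∈ ρ | inj₁ (x , y , T′ , x∈ , π , e)
      with grow f (y ∷ S) T′ (≤-pred (≤-trans (≤-reflexive (sym (↭-length π))) le)) (there v∈)
             ((All.lookup ρ x∈ ◅◅ (e ◅ ε)) ∷ ρ)
    ... | S′ , T″ , π′ , rest = S′ , T″ , ↭-trans (++⁺ˡ S π) (↭-trans (shift y S T′) π′) , rest

  -- Vertices of `D` are reached from `d` in two steps through `b`. Hence any K4s in the colour of a
  -- cut lie in one component.
  cross-reach : ∀ {k D B d b} → Cross k D B → d ∈ D → b ∈ B → All (Reach k d) (D ++ B)
  cross-reach {D = D} cr d∈ b∈ = All.++⁺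
    (All.tabulate λ x∈ → cr d∈ b∈ ◅ (mono-sym (cr x∈ b∈) ◅ ε)) (All.tabulate λ y∈ → cr d∈ y∈ ◅ ε)

  Outcome : Fin 2 → ℕ → List V → Set
  Outcome k n X = ConnectedK4s k n X ⊎ ConnectedK4s (opp k) n X

  cut-outcome : ∀ {k n X D B d b} → X ↭ D ++ B → Cross (opp k) D B → d ∈ D → b ∈ B →
    ConnectedK4s k n (D ++ B) ⊎ Packed (Clique (opp k) 4) n (D ++ B) → Outcome k n X
  cut-outcome π cr d∈ b∈ (inj₁ r) = inj₁ (connectedK4s-⊇ (↭-trans π (↭-sym (↭-++-identityʳ _))) r)
  cut-outcome π cr d∈ b∈ (inj₂ (_ , p)) =
    inj₂ (_ , _ , pack-↭ π (pack-All (cross-reach cr d∈ b∈) p))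

  pack-head : ∀ {k m t xs r} → Pack (Clique k m) (suc t) xs r → HasClique k m xs
  pack-head (more π b _) = _ , _ , π , b

  pack-last : ∀ {k m t xs r} → Pack (Clique k m) (suc t) xs r → PackPlus k m t m xs
  pack-last {xs = xs} (more π b (done π′)) = xs , done ↭-refl , _ , _ , π , b
  pack-last (more π b p@(more _ _ _)) with pack-last p
  ... | r , p′ , h = r , more π b p′ , h

  -- K4s of colour `opp k` are divided between `D` and `B` as 4+0 with a last 3+1 when |B| < n, as
  -- 3+1 when n ≤ |B| < 4n, and as 3+1 with a last 2+2 when |B| ≥ 4n. If `D` fails to supply its
  -- share, it contains `n` K4s of colour `k`, connected by `ρ`.
  connected-part : ∀ {k j v D B} → 3 + (length D + length B) ≡ (2 + j) * 13 → (2 + j) * 8 ≤ 2 + length D →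
    All (Reach k v) D → Cross (opp k) D B → 1 ≤ length B →
    ConnectedK4s k (2 + j) (D ++ B) ⊎ Packed (Clique (opp k) 4) (2 + j) (D ++ B)
  connected-part {k} {j} {v} {D} {B} tot large ρ cr 1≤B = by-size (length B <? n) (length B <? n * 4)
    where
    n = 2 + j

    inside : Packed (Clique k 4) n D → ConnectedK4s k n (D ++ B) ⊎ Packed (Clique (opp k) 4) n (D ++ B)
    inside (_ , p) = inj₁ (connectedK4s-⊇ ↭-refl (v , _ , pack-All ρ p))

    -- With |B| ≥ 4n neither alternative of `Matching` allows m = 0, and a single edge is enough.
    edge-outside : n * 4 ≤ length B → Matching (opp k) n B → PackPlus (opp k) 1 (1 + j) 2 B
    edge-outside 4n≤ (m , _ , (_ , p) , d) with pack-truncate (positive d) p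
      where
      positive : m ≡ n ⊎ length B < n * 4 + m → 1 ≤ m
      positive (inj₁ refl) = s≤s z≤n
      positive (inj₂ lt)   = +-cancelˡ-≤ (n * 4) 1 m
        (≤-trans (≤-reflexive (+-comm (n * 4) 1)) (≤-trans (s≤s 4n≤) lt))
    ... | r , e with singletons-first (1 + j) e (rest-singletons j _ _ 4n≤ (pack-length proj₁ e))
    ... | r′ , _ , q , e′ , _ = r′ , q , pack-head e′

    by-size : Dec (length B < n) → Dec (length B < n * 4) →
              ConnectedK4s k n (D ++ B) ⊎ Packed (Clique (opp k) 4) n (D ++ B)
    -- Here |D| ≥ 12n - 2, so L = 8n + 2 vertices remain after n - 1 K4s are removed.
    by-size (yes b<n) _ =
      [ inside , (λ p → inj₂ (packPlus-join cr refl p (B , pack-empty (1 + j) B , pack-head (proj₂ (pack-singletons 1 B 1≤B))))) ]′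
      (K4s-or-packPlus {p = 18} {9} {4} {1 + j} {3} {n = n} {D}
        arrow-⟨4,4⟩ arrow-⟨4,3⟩ (18+4t≤ j) (9+4t≤ j) (few-outside j _ _ tot b<n))
    -- Here |D| ≥ 9n - 2 and L = 5n + 2.
    by-size (no b≮n) (yes b<4n) =
      [ inside , (λ p → inj₂ (packPlus-join cr refl p (pack-last (proj₂ (pack-singletons n B (≮⇒≥ b≮n)))))) ]′
      (K4s-or-packPlus {p = 9} {9} {3} {1 + j} {3} {n = n} {D}
        arrow-⟨4,3⟩ arrow-⟨4,3⟩ (≤-trans (9+3t≤₁ j) (m≤n+m _ 3)) (9+3t≤₁ j) (some-outside j _ _ tot b<4n))
    -- Here only |D| ≥ 8n - 2 is known, and L = 4n + 2.
    by-size (no _) (no b≮4n) with matching k n B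
    ... | inj₁ r = inj₁ (connectedK4s-⊇ (↭-++-comm D B) r)
    ... | inj₂ M =
      [ inside , (λ p → inj₂ (packPlus-join cr refl p (edge-outside (≮⇒≥ b≮4n) M))) ]′
      (K4s-or-packPlus {p = 9} {4} {3} {1 + j} {2} {n = n} {D}
        arrow-⟨4,3⟩ arrow-⟨ 3 ,2⟩ (9+3t≤₂ j) (4+3t≤ j) (large-inside j _ large))

  -- The minimal closed set is reached by descending into a part that is still large.
  connected-or-outcome : ∀ k j X → 3 + length X ≡ (2 + j) * 13 →
    Outcome k (2 + j) X ⊎ ∃ λ v → All (Reach k v) X
  connected-or-outcome k j X total =
    Sum.map₂ proj₂ (descend (length X) X [] ≤-refl (↭-sym (↭-++-identityʳ X)) (λ _ ()) (start-large j _ total))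
    where
    n = 2 + j

    sizes : ∀ D {B} → X ↭ D ++ B → 3 + (length D + length B) ≡ n * 13
    sizes D π = trans (cong (3 +_) (sym (trans (↭-length π) (length-++ D)))) total

    -- `f` is fuel bounding |D|. The equation `B ≡ []` is refuted after a genuine split, where the
    -- complement is nonempty.
    descend : ∀ f D B → length D ≤ f → X ↭ D ++ B → Cross (opp k) D B → n * 8 ≤ 2 + length D →
              Outcome k n X ⊎ (B ≡ [] × ∃ λ v → All (Reach k v) D)
    descend f       []      B le π cr (s≤s (s≤s ()))
    descend (suc f) (v ∷ D) B (s≤s le) π cr large with component k v D
    ... | S , [] , σ , v∈ , ρ , _ = connected B π cr
      where
      reached : All (Reach k v) (v ∷ D)
      reached = All-resp-↭ (↭-sym (↭-trans σ (↭-++-identityʳ S))) ρ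

      connected : ∀ B → X ↭ v ∷ D ++ B → Cross (opp k) (v ∷ D) B →
                  Outcome k n X ⊎ (B ≡ [] × ∃ λ u → All (Reach k u) (v ∷ D))
      connected []      π cr = inj₂ (refl , v , reached)
      connected (b ∷ B) π cr = inj₁ (cut-outcome π cr (here refl) (here refl)
        (connected-part (sizes (v ∷ D) π) large reached cr (s≤s z≤n)))
    ... | S , T@(_ ∷ T′) , σ , v∈ , ρ , cST = split (n * 8 ≤? 2 + length S) (n * 8 ≤? 2 + length T)
      where
      cSB : Cross (opp k) S B
      cSB x∈ = cr (∈-resp-↭ (↭-sym σ) (∈-++⁺ˡ x∈))

      cTB : Cross (opp k) T B
      cTB x∈ = cr (∈-resp-↭ (↭-sym σ) (∈-++⁺ʳ S x∈))

      cS : Cross (opp k) S (T ++ B)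
      cS x∈ y∈ = [ cST x∈ , cSB x∈ ]′ (∈-++⁻ T y∈)

      cT : Cross (opp k) T (S ++ B)
      cT x∈ y∈ = [ (λ y∈S → mono-sym (cST y∈S x∈)) , cTB x∈ ]′ (∈-++⁻ S y∈)

      πS : X ↭ S ++ (T ++ B)
      πS = ↭-trans π (↭-trans (++⁺ʳ B σ) (↭-++-assoc S T B))

      πT : X ↭ T ++ (S ++ B)
      πT = ↭-trans πS (solve↭ 3 (λ s t b → s ⊕ (t ⊕ b) ⊜ t ⊕ (s ⊕ b)) ↭-refl S T B)

      |D| : suc (length D) ≡ length S + length T
      |D| = trans (↭-length σ) (length-++ S)

      1≤S : 1 ≤ length S
      1≤S = nonempty v∈
        where
        nonempty : ∀ {S} → v ∈ S → 1 ≤ length S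
        nonempty (here _)  = s≤s z≤n
        nonempty (there _) = s≤s z≤n

      S≤f : length S ≤ f
      S≤f = ≤-trans (m≤m+n _ (length T′))
        (≤-trans (≤-reflexive (suc-injective (trans (sym (+-suc (length S) _)) (sym |D|)))) le)

      T≤f : length T ≤ f
      T≤f = ≤-pred (≤-trans (+-monoˡ-≤ (length T) 1≤S) (≤-trans (≤-reflexive (sym |D|)) (s≤s le)))

      split : Dec (n * 8 ≤ 2 + length S) → Dec (n * 8 ≤ 2 + length T) →
              Outcome k n X ⊎ (B ≡ [] × ∃ λ u → All (Reach k u) (v ∷ D))
      split (yes lS) _ with descend f S (T ++ B) S≤f πS cS lS
      ... | inj₁ o = inj₁ o
      split (no _) (yes lT) with descend f T (S ++ B) T≤f πT cT lT
      ... | inj₁ o = inj₁ o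
      ... | inj₂ (e , _) = contradiction (subst (λ L → 1 ≤ length L) (++-conicalˡ S B e) 1≤S) λ ()
      -- Each part has at most 8n - 3 vertices, so its complement has at least 5n and the part
      -- itself must have fewer than 5n. Then `S`, `T` and `B` all have at least 3n - 1 ≥ 2n
      -- vertices.
      split (no ¬lS) (no ¬lT) with two-parts n cS | two-parts n cT
      ... | inj₁ o | _ = inj₁ (cut-outcome πS cS v∈ (here refl) o)
      ... | _ | inj₁ o = inj₁ (cut-outcome πT cT (here refl) (∈-++⁺ˡ v∈) o)
      ... | inj₂ (inj₂ lt) | _ = contradiction (cut-sizes n _ _ (sizes S πS) (≰⇒> ¬lS)) (<⇒≱ lt)
      ... | _ | inj₂ (inj₂ lt) = contradiction (cut-sizes n _ _ (sizes T πT) (≰⇒> ¬lT)) (<⇒≱ lt)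
      ... | inj₂ (inj₁ ltS) | inj₂ (inj₁ ltT) = inj₁ (cut-outcome πS cS v∈ (here refl)
              (three-parts cST cSB cTB
                (part-large n _ _ _ (s≤s z≤n) |D| large ltT)
                (part-large n _ _ _ (s≤s z≤n) (trans |D| (+-comm (length S) _)) large ltS)
                (outside-large n _ _ _ _ (s≤s z≤n) |D| (sizes (v ∷ D) π) ltS ltT)
                (≤-reflexive (sym (trans (cong (λ i → 3 + (length S + i)) (sym (length-++ T))) (sizes S πS))))))

  -- Both colours connected.

  -- A search takes place only while `a` and `b` are positive, where 10 + 4(a + b) ≥ 18 and R(4,4) ≤
  -- 18 applies. For a = b = n, the inequality 8n + 10 ≤ 13n - 3 holds from n = 3 on.
  mono-K4s : ∀ {k} a b xs → 10 + (a + b) * 4 ≤ length xs →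
             Packed (Clique k 4) a xs ⊎ Packed (Clique (opp k) 4) b xs
  mono-K4s zero    b       xs le = inj₁ (xs , done ↭-refl)
  mono-K4s (suc a) zero    xs le = inj₂ (xs , done ↭-refl)
  mono-K4s {k} (suc a) (suc b) xs le with arrow-⟨4,4⟩ {k} xs (≤-trans (mono-find a b) le)
  ... | inj₁ (q , r , π , cl@(|q| , _)) with mono-K4s a (suc b) r
          (mono-rest₁ a b _ _ (trans (↭-length π) (trans (length-++ q) (cong (_+ length r) |q|))) le)
  ...   | inj₁ (_ , p) = inj₁ (_ , more π cl p)
  ...   | inj₂ p = inj₂ (packed-⊇ (↭-trans π (↭-++-comm q r)) p)
  mono-K4s {k} (suc a) (suc b) xs le | inj₂ (q , r , π , cl@(|q| , _)) with mono-K4s (suc a) b r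
          (mono-rest₂ a b _ _ (trans (↭-length π) (trans (length-++ q) (cong (_+ length r) |q|))) le)
  ...   | inj₁ p = inj₁ (packed-⊇ (↭-trans π (↭-++-comm q r)) p)
  ...   | inj₂ (_ , p) = inj₂ (_ , more π cl p)

  connected-packed : ∀ {k v n X} → All (Reach k v) X → Packed (Clique k 4) n X → ConnectedK4s k n X
  connected-packed ρ (_ , p) = _ , _ , pack-All ρ p

-- From packings to copies in connected graphs.

module _ {N : ℕ} (χ : Colouring N) where

  open Cliques (col χ) (colSym χ)
  open DecMembership (_≟ᶠ_ {N}) using (_∈?_)

  block : ∀ {m} (q : List (Fin N)) → length q ≡ m → Fin m → Fin N
  block q refl = lookup q

  block-∈ : ∀ {m} q (e : length q ≡ m) a → block q e a ∈ q
  block-∈ q refl = ∈-lookup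

  block-pairs : ∀ {m} {R : Fin N → Fin N → Set} q (e : length q ≡ m) → (∀ {x y} → R x y → R y x) →
                AllPairs R q → ∀ {a b} → a ≢ b → R (block q e a) (block q e b)
  block-pairs q refl s = AllPairs-lookup s

  -- Distinctness of the vertices enters here. Membership in `xs` is carried through the induction
  -- because it separates the later blocks from the first.
  embed : ∀ {k w n xs r} → Unique xs → Pack (ConnectedK4 k w) n xs r →
          Σ (MonoCopy χ k (nK4 n)) λ { (f , _) → ∀ u → f u ∈ xs × Reach k w (f u) }
  embed uniq (done _) = ((λ { (() , _) }) , (λ { {() , _} }) , (λ { {() , _} })) , λ { (() , _) }
  embed {k} {w} {suc n} {xs} uniq (more {q = q} {ys} π ((|q| , α) , ρ) p)
    with AllPairs-++⁻ q (Permutationₛ.Unique-resp-↭ (setoid (Fin N)) (↭⇒↭ₛ π) uniq)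
  ... | uq , uy , apart with embed uy p
  ... | (g , g-inj , g-mono) , g-in = (f , f-inj , f-mono) , f-in
    where
    f : Fin (suc n) × Fin 4 → Fin N
    f (zero  , a) = block q |q| a
    f (suc i , a) = g (i , a)

    separate : ∀ a u → block q |q| a ≢ g u
    separate a u = All.lookup (All.lookup apart (block-∈ q |q| a)) (proj₁ (g-in u))

    f-inj : Injective _≡_ _≡_ f
    f-inj {zero , a} {zero , b} e with a ≟ᶠ b
    ... | yes refl = refl
    ... | no a≢b   = contradiction e (block-pairs q |q| (_∘ sym) uq a≢b)
    f-inj {zero  , a} {suc i , b} e = contradiction e (separate a (i , b))
    f-inj {suc i , a} {zero  , b} e = contradiction (sym e) (separate b (i , a))
    f-inj {suc i , a} {suc j , b} e with g-inj e
    ... | refl = refl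

    f-mono : ∀ {u v} → E (nK4 (suc n)) u v → col χ (f u) (f v) ≡ k
    f-mono {zero  , a} {zero  , b} (_ , a≢b)    = block-pairs q |q| mono-sym α a≢b
    f-mono {suc i , a} {suc .i , b} (refl , a≢b) = g-mono (refl , a≢b)

    f-in : ∀ u → f u ∈ xs × Reach k w (f u)
    f-in (zero  , a) = ∈-resp-↭ (↭-sym π) (∈-++⁺ˡ (block-∈ q |q| a)) , All.lookup ρ (block-∈ q |q| a)
    f-in (suc i , a) with g-in (i , a)
    ... | in-ys , r = ∈-resp-↭ (↭-sym π) (∈-++⁺ʳ q in-ys) , r

  component-∈ : ∀ {k w xs} → w ∈ xs → Component k w xs
  component-∈ {k} {w} w∈ with ∈-∃++ w∈
  ... | ys , zs , refl with component k w (ys ++ zs)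
  ... | S , T , π , rest = S , T , ↭-trans (shift w ys zs) π , rest

  module ComponentGraph {k w} (comp : Component k w (allFin N)) where

    S : List (Fin N)
    S = proj₁ comp

    closed : ∀ {u v} → u ∈ S → Mono k u v → v ∈ S
    closed {v = v} u∈ e = let _ , _ , π , _ , _ , cr = comp in
      [ id , (λ v∈ → contradiction (trans (sym e) (cr u∈ v∈)) (opp-≢ k)) ]′
      (∈-++⁻ S (∈-resp-↭ π (∈-allFin v)))

    reached-∈ : ∀ {v} → Reach k w v → v ∈ S
    reached-∈ = let _ , _ , _ , w∈ , _ = comp in along w∈
      where
      along : ∀ {u v} → u ∈ S → Reach k u v → v ∈ S
      along u∈ ε       = u∈
      along u∈ (e ◅ p) = along (closed u∈ e) p

    -- `True` makes membership proofs unique, so that the projection to `Fin N` is injective. The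
    -- condition `u ≢ v` excludes the arbitrary diagonal of the colouring.
    graph : Graph
    graph = record
      { V      = Σ (Fin N) λ v → True (v ∈? S)
      ; E      = λ { (u , _) (v , _) → u ≢ v × Mono k u v }
      ; sym    = λ { (u≢v , e) → u≢v ∘ sym , mono-sym e }
      ; irrefl = λ { (u≢u , _) → u≢u refl }
      }

    path : ∀ {u v} {tu : True (u ∈? S)} {tv : True (v ∈? S)} → Reach k u v →
           Reachable graph (u , tu) (v , tv)
    path {u} {tu = tu} {tv} ε rewrite T-irrelevant tu tv = here
    path {u} {tu = tu} (_◅_ {j = x} e p) with u ≟ᶠ x
    -- A step along a diagonal entry is a loop and is dropped.
    ... | yes refl = path p
    ... | no u≢x   = step {w = x , fromWitness (closed (toWitness tu) e)} (u≢x , e) (path p)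

    connected : Connected graph
    connected (u , tu) (v , tv) = path (reverse mono-sym (from-w tu) ◅◅ from-w tv)
      where
      from-w : ∀ {u} → True (u ∈? S) → Reach k w u
      from-w tu = let _ , _ , _ , _ , ρ , _ = comp in All.lookup ρ (toWitness tu)

  connected-copy : ∀ {k n w} (copy : MonoCopy χ k (nK4 n)) → (∀ u → Reach k w (proj₁ copy u)) →
                   Σ Graph λ G → InC (nK4 n) G × MonoCopy χ k G
  connected-copy {w = w} (f , f-inj , f-mono) reach = graph
      , (connected
        , (λ u → f u , fromWitness (reached-∈ (reach u)))
        , (λ e → f-inj (cong proj₁ e))
        , λ { {i , a} {j , b} (i≡j , a≢b) → (λ e → a≢b (cong proj₂ (f-inj e))) , f-mono (i≡j , a≢b) })
      , proj₁ , (λ { {u , tu} {.u , tv} refl → cong (u ,_) (T-irrelevant tu tv) }) , proj₂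
    where open ComponentGraph (component-∈ (∈-allFin w))

  connectedK4s-copy : ∀ {k n} → ConnectedK4s k n (allFin N) → Σ Graph λ G → InC (nK4 n) G × MonoCopy χ k G
  connectedK4s-copy (w , _ , p) with embed (allFin⁺ N) p
  ... | copy , in-reach = connected-copy copy (proj₂ ∘ in-reach)

-- The upper bound.

module _ {N j : ℕ} (total : 3 + N ≡ (2 + j) * 13) where

  private
    n = 2 + j

    |allFin| : 3 + length (allFin N) ≡ n * 13
    |allFin| = trans (cong (3 +_) (length-tabulate {n = N} id)) total

  -- A disconnected colour already yields a copy, so only the connected case is left to the
  -- continuation `both`, which differs between n ≥ 3 and n = 2.
  arrowsC-if-connected : ∀ (χ : Colouring N) → let open Cliques (col χ) (colSym χ) in
    ((∀ k → ∃ λ v → All (Reach k v) (allFin N)) →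
      Σ (Fin 2) λ k → Σ Graph λ G → InC (nK4 n) G × MonoCopy χ k G) →
    Σ (Fin 2) λ k → Σ Graph λ G → InC (nK4 n) G × MonoCopy χ k G
  arrowsC-if-connected χ both =
    [ found zero , (λ c₀ → [ found (suc zero) , (λ c₁ → both λ { zero → c₀ ; (suc zero) → c₁ }) ]′
      (connected-or-outcome (suc zero) j (allFin N) |allFin|)) ]′
    (connected-or-outcome zero j (allFin N) |allFin|)
    where
    open Cliques (col χ) (colSym χ)

    found : ∀ k → Outcome k n (allFin N) → Σ (Fin 2) λ k → Σ Graph λ G → InC (nK4 n) G × MonoCopy χ k G
    found k (inj₁ c) = k     , connectedK4s-copy χ c
    found k (inj₂ c) = opp k , connectedK4s-copy χ c

  arrowsC-upper : 3 ≤ n → ArrowsC N (nK4 n)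
  arrowsC-upper 3≤n χ = arrowsC-if-connected χ λ c →
    [ (λ p → zero     , connectedK4s-copy χ (connected-packed (proj₂ (c zero)) p))
    , (λ p → suc zero , connectedK4s-copy χ (connected-packed (proj₂ (c (suc zero))) p)) ]′
    (mono-K4s n n (allFin N) (plenty n _ 3≤n |allFin|))
    where open Cliques (col χ) (colSym χ)

  arrows⇒arrowsC : Arrows N (nK4 n) → ArrowsC N (nK4 n)
  arrows⇒arrowsC A χ = arrowsC-if-connected χ λ c →
    let k , copy = A χ in k , connected-copy χ copy (λ u → All.lookup (proj₂ (c k)) (∈-allFin _))

-- Restriction to the first `r` vertices; it turns the bound R₂(2K₄) ≤ 23 into an arrow at 23.
arrows-mono : ∀ {r N H} → r ≤ N → Arrows r H → Arrows N H
arrows-mono r≤N A χ with A (record { col = λ i j → col χ (inject≤ i r≤N) (inject≤ j r≤N)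
                                   ; colSym = λ i j → colSym χ _ _ })
... | k , f , f-inj , f-mono =
      k , (λ u → inject≤ (f u) r≤N) , (λ e → f-inj (inject≤-injective r≤N r≤N _ _ e)) , f-mono

total-size : ∀ j → 3 + (13 * (2 + j) ∸ 3) ≡ (2 + j) * 13
total-size j = trans (m+[n∸m]≡n (≤-trans (m≤m+n 3 (23 + j * 13)) (≤-reflexive (arith j)))) (*-comm 13 (2 + j))
  where
  arith : ∀ j → 3 + (23 + j * 13) ≡ 13 * (2 + j)
  arith = solve-∀

-- The lower bound construction.

-- Classes 0, 1, 2 are the three red cliques (red is 0); class 3 is the n-1 further vertices.
shade : ℕ → ℕ → Fin 2
shade a b with a ≟ b | a <? 3
... | yes _ | yes _ = zero
... | yes _ | no _  = suc zero
... | no _  | _     = suc zero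

shade-sym : ∀ a b → shade a b ≡ shade b a
shade-sym a b with a ≟ b
... | yes refl with a ≟ a | a <? 3
...   | yes _ | yes _ = refl
...   | yes _ | no _  = refl
...   | no ¬e | _     = contradiction refl ¬e
shade-sym a b | no ¬e with b ≟ a
...   | yes e = contradiction (sym e) ¬e
...   | no _  = refl

shade-0 : ∀ a b → shade a b ≡ zero → a ≡ b
shade-0 a b eq with a ≟ b | a <? 3
shade-0 a b eq | yes e | yes _ = e
shade-0 a b () | yes _ | no _
shade-0 a b () | no _  | _

shade-1 : ∀ a b → a < 3 → shade a b ≡ suc zero → a ≢ b
shade-1 a b l eq e with a ≟ b | a <? 3
shade-1 a b l () e | yes _ | yes _
shade-1 a b l eq e | yes _ | no ¬l = ¬l l
shade-1 a b l eq e | no ¬e | _     = ¬e e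

-- `width` is 4n - 1, and the bound on `m` is 13n - 4 = 3(4n - 1) + (n - 1).
module LowerBound (p m : ℕ) (m≤ : m ≤ 9 + p * 13) where

  n width : ℕ
  n     = suc p
  width = 3 + p * 4

  class : Fin m → ℕ
  class i = toℕ i / width

  χ : Colouring m
  χ = record
    { col    = λ i j → shade (class i) (class j)
    ; colSym = λ i j → shade-sym (class i) (class j)
    }

  class-injective : ∀ {i j} → class i ≡ class j → toℕ i % width ≡ toℕ j % width → i ≡ j
  class-injective {i} {j} q r = toℕ-injective (trans (m≡m%n+[m/n]*n (toℕ i) width)
    (trans (cong₂ (λ a b → a + b * width) r q) (sym (m≡m%n+[m/n]*n (toℕ j) width))))

  -- Within a class the residue modulo `width` determines the vertex, and 4n vertices do not fit
  -- into 4n - 1 residues.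
  no-copy-in-class : (h : Fin n × Fin 4 → Fin m) → Injective _≡_ _≡_ h →
                     ¬ (∀ u v → class (h u) ≡ class (h v))
  no-copy-in-class h h-inj same =
    let i , j , i<j , e = pigeonhole {m = width} {n = n * 4} ≤-refl (λ i → fromℕ< (bound i)) in
    <ᶠ⇒≢ i<j (trans (sym (combine-remQuot {n} 4 i))
      (trans (cong (uncurry combine) (h-inj (class-injective (same _ _)
        (fromℕ<-injective _ _ (bound i) (bound j) e)))) (combine-remQuot {n} 4 j)))
    where
    bound : ∀ i → toℕ (h (remQuot 4 i)) % width < width
    bound i = m%n<n (toℕ (h (remQuot 4 i))) width

  no-disjoint-K4s : (h : Fin n × Fin 4 → Fin m) → Injective _≡_ _≡_ h →
                    ¬ (∀ {u v} → E (nK4 n) u v → col χ (h u) (h v) ≡ suc zero)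
  no-disjoint-K4s h h-inj mono =
    let i , j , i<j , e = pigeonhole {m = p} {n = n} ≤-refl (λ i → fromℕ< (bound i)) in
    <ᶠ⇒≢ i<j (cong proj₁ (h-inj (toℕ-injective (∸-cancelʳ-≡ (late i) (late j)
      (fromℕ<-injective _ _ (bound i) (bound j) e)))))
    where
    outside : ∀ i → ∃ λ a → ¬ class (h (i , a)) < 3
    -- Four vertices in three red cliques would put two into the same one, joined by a red edge.
    outside i = ¬∀⟶∃¬ 4 _ (λ a → class (h (i , a)) <? 3) λ inside →
      let a , b , a<b , e = pigeonhole {m = 3} {n = 4} ≤-refl (λ a → fromℕ< (inside a)) in
      shade-1 _ _ (inside a) (mono (refl , <ᶠ⇒≢ a<b)) (fromℕ<-injective _ _ (inside a) (inside b) e)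

    vertex : Fin n → Fin m
    vertex i = h (i , proj₁ (outside i))

    -- Subtracting `3 * width` numbers the further vertices below p = n - 1, too few for one in each
    -- of `n` disjoint K4s.
    late : ∀ i → 3 * width ≤ toℕ (vertex i)
    late i = ≤-trans (*-monoˡ-≤ width (≮⇒≥ (proj₂ (outside i)))) (m/n*n≤m (toℕ (vertex i)) width)

    bound : ∀ i → toℕ (vertex i) ∸ 3 * width < p
    bound i = +-cancelˡ-< (3 * width) _ _ (≤-trans (≤-reflexive (cong suc (m+[n∸m]≡n (late i))))
      (≤-trans (toℕ<n (vertex i)) (≤-trans m≤ (≤-reflexive (arith p)))))
      where
      arith : ∀ p → 9 + p * 13 ≡ 3 * (3 + p * 4) + p
      arith = solve-∀

  no-arrow : ¬ ArrowsC m (nK4 n)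
  no-arrow A with A χ
  -- Red edges stay within a class, so connectivity of `G` puts the whole copy into one class.
  ... | zero , G , (conn , g , g-inj , g-edge) , f , f-inj , f-edge =
        no-copy-in-class (f ∘ g) (g-inj ∘ f-inj) (λ u v → same (conn (g u) (g v)))
    where
    same : ∀ {u v} → Reachable G u v → class (f u) ≡ class (f v)
    same here       = refl
    same (step e r) = trans (shade-0 _ _ (f-edge e)) (same r)
  ... | suc zero , G , (conn , g , g-inj , g-edge) , f , f-inj , f-edge =
        no-disjoint-K4s (f ∘ g) (g-inj ∘ f-inj) (f-edge ∘ g-edge)

¬arrowsC-lower : ∀ n → 1 ≤ n → ∀ m → m < 13 * n ∸ 3 → ¬ ArrowsC m (nK4 n)
¬arrowsC-lower (suc p) _ m m< = LowerBound.no-arrow p m (≤-pred (≤-trans m< (≤-reflexive size)))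
  where
  arith : ∀ p → 13 * suc p ≡ 3 + (10 + p * 13)
  arith = solve-∀
  size : 13 * suc p ∸ 3 ≡ 10 + p * 13
  size = cong (_∸ 3) (arith p)

theorem2p5 : ((n : ℕ) → 3 ≤ n → R₂c≡ (nK4 n) (13 * n ∸ 3))
    × ((Σ ℕ λ r → R₂≡ (nK4 2) r × r ≤ 23) → R₂c≡ (nK4 2) 23)
theorem2p5 = first , second
  where
  first : (n : ℕ) → 3 ≤ n → R₂c≡ (nK4 n) (13 * n ∸ 3)
  first (suc zero)      (s≤s ())
  first n@(suc (suc j)) 3≤n = arrowsC-upper (total-size j) 3≤n , ¬arrowsC-lower n (s≤s z≤n)

  second : (Σ ℕ λ r → R₂≡ (nK4 2) r × r ≤ 23) → R₂c≡ (nK4 2) 23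
  second (r , (A , _) , r≤23) =
    arrows⇒arrowsC {j = 0} refl (arrows-mono {H = nK4 2} r≤23 A) , ¬arrowsC-lower 2 (s≤s z≤n)
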